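{- Let $k \ge r \ge 1$ be integers and let $\mathcal{F}$ be a family of $r$-graphs, each having at least one edge. If every member of $\mathcal{F}$ is a pair-covering $r$-graph, then the limit $$\lim_{n\to\infty} L(n,k,r,\mathcal{F})\, n^{ -r}$$ exists (as a finite real number).
   Context: For a positive integer $k$, a $k$-graph with (finite) vertex set $V$ is a system (set) of $k$-element subsets of $V$, called edges. The complement of an $r$-graph on $V$ is the $r$-graph on $V$ whose edges are exactly the $r$-element subsets of $V$ that are not edges of the original. For $r \le k$, the $r$-shadow of a $k$-graph $H$ is the $r$-graph with the same vertex set whose edges are the $r$-element subsets of $V$ contained in edges of $H$. An $r$-graph is $\mathcal{F}$-free if it does not contain a (not necessarily induced) subgraph isomorphic to a member of $\mathcal{F}$. An $r$-graph is pair-covering if any pair of (distinct) vertices of it is contained in an edge. $L(n,k,r,\mathcal{F})$ denotes the minimum number of edges in an $n$-vertex $k$-graph such that the complement of its $r$-shadow is $\mathcal{F}$-free. This is considered for $n \ge k$, where the minimum is over a nonempty set since the complete $k$-graph qualifies. -}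

module Defs where

open import Axiom.ExcludedMiddle using (ExcludedMiddle)
open import Data.Bool.Base using (Bool; T)
open import Data.Bool.Properties using (T?)
open import Data.Fin.Base using (Fin)
import Data.Fin.Properties as Fin
open import Data.Fin.Subset using (Subset; inside; outside; _∈_; _⊆_; ∣_∣; ⊤)
open import Data.Fin.Subset.Properties
  using (_∈?_; _⊆?_; anySubset?; out⊆; s⊆s; ⊆⊤; ∣⊤∣≡n)
open import Data.Integer.Base using (+_)
open import Data.List.Base using (List; []; _∷_; _++_; map; filter; length)
open import Data.Nat.Base
  using (ℕ; zero; suc; _^_; _≤_; _<_; z≤n; s≤s; NonZero; >-nonZero)
open import Data.Nat.Induction using (<-wellFounded)
import Data.Nat.Properties as ℕ
open import Data.Product.Base using (Σ-syntax; ∃; ∃-syntax; _×_; _,_; proj₁; proj₂)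
open import Data.Rational.Base as ℚ using (ℚ; Positive; _/_)
open import Data.Sum.Base using (_⊎_; inj₁; inj₂)
open import Data.Vec.Base using ([]; _∷_; tabulate)
open import Function.Base using (id)
open import Function.Definitions using (Injective)
open import Induction.WellFounded using (Acc; acc)
open import Level using (Level)
open import Relation.Binary.PropositionalEquality using (_≡_; _≢_; refl; cong)
open import Relation.Nullary using (¬_; yes; no; does)
open import Relation.Nullary.Decidable using (⌊_⌋; toWitness; fromWitness; ¬?; _×-dec_)
open import Relation.Unary using (Pred; Decidable)

private
  variable
    ℓ : Level
    k r m n : ℕ

-- A k-graph with vertex set Fin n: a set of subsets of size k, given by its
-- characteristic function.
record Graph (k n : ℕ) : Set where
  field
    isEdge  : Subset n → Bool
    uniform : ∀ {e} → T (isEdge e) → ∣ e ∣ ≡ k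

  Edge : Pred (Subset n) _
  Edge e = T (isEdge e)

  edge? : Decidable Edge
  edge? e = T? (isEdge e)

open Graph public using (Edge; edge?)

comprehension : ∀ {P : Pred (Subset n) ℓ} → Decidable P →
                (∀ {e} → P e → ∣ e ∣ ≡ k) → Graph k n
comprehension P? P⇒size = record
  { isEdge  = λ e → ⌊ P? e ⌋
  ; uniform = λ {e} t → P⇒size (toWitness {a? = P? e} t)
  }

complete : ∀ k n → Graph k n
complete k n = comprehension (λ e → ∣ e ∣ ℕ.≟ k) id

complement : Graph r n → Graph r n
complement {r} G =
  comprehension (λ e → (∣ e ∣ ℕ.≟ r) ×-dec ¬? (edge? G e)) proj₁

shadow : ∀ r → Graph k n → Graph r n
shadow r H = comprehension
  (λ s → (∣ s ∣ ℕ.≟ r) ×-dec anySubset? (λ e → edge? H e ×-dec (s ⊆? e))) proj₁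

allSubsets : ∀ n → List (Subset n)
allSubsets zero    = [] ∷ []
allSubsets (suc n) =
  map (outside ∷_) (allSubsets n) ++ map (inside ∷_) (allSubsets n)

edgeCount : Graph k n → ℕ
edgeCount {n = n} G = length (filter (edge? G) (allSubsets n))

image : (Fin m → Fin n) → Subset m → Subset n
image f s = tabulate λ y → does (Fin.any? λ x → (x ∈? s) ×-dec (f x Fin.≟ y))

-- An isomorphism from G onto a (not necessarily induced) subgraph of H.
record _↪_ (G : Graph r m) (H : Graph r n) : Set where
  field
    to        : Fin m → Fin n
    injective : Injective _≡_ _≡_ to
    edges     : ∀ {e} → Edge G e → Edge H (image to e)

HasEdge : Graph r n → Set
HasEdge G = ∃[ e ] Edge G e

PairCovering : Graph r n → Set
PairCovering {n = n} G =
  ∀ (x y : Fin n) → x ≢ y → ∃[ e ] Edge G e × x ∈ e × y ∈ e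

-- A possibly infinite, possibly empty family of finite r-graphs.
Family : ℕ → (ℓ : Level) → Set (Level.suc ℓ)
Family r ℓ = ∀ v → Pred (Graph r v) ℓ

Every : Family r ℓ → (∀ {v} → Graph r v → Set) → Set ℓ
Every {r} F P = ∀ {v} (G : Graph r v) → F v G → P G

Free : Family r ℓ → Graph r n → Set ℓ
Free F H = Every F λ G → ¬ (G ↪ H)

Admissible : Family r ℓ → Graph k n → Set ℓ
Admissible {r} F H = Free F (complement (shadow r H))

SizeOfAdmissible : ∀ n k → Family r ℓ → Pred ℕ ℓ
SizeOfAdmissible n k F s = Σ[ H ∈ Graph k n ] Admissible F H × edgeCount H ≡ s

IsMinimum : Pred ℕ ℓ → Pred ℕ ℓ
IsMinimum P s = P s × (∀ t → P t → s ≤ t)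

-- An inhabited set of naturals need not have a minimum constructively.
minimum : ExcludedMiddle ℓ → (P : Pred ℕ ℓ) → ∃ P → ∃ (IsMinimum P)
minimum {ℓ} em P (s , Ps) = descend s (<-wellFounded s) Ps
  where
  descend : ∀ s → Acc _<_ s → P s → ∃ (IsMinimum P)
  descend s (acc rec) Ps with em {∃[ t ] t < s × P t}
  ... | yes (t , t<s , Pt) = descend t (rec t<s) Pt
  ... | no  none = s , Ps , λ t Pt → ℕ.≮⇒≥ λ t<s → none (t , t<s , Pt)

enlarge : ∀ (s : Subset n) k → ∣ s ∣ ≤ k → k ≤ n → ∃[ e ] ∣ e ∣ ≡ k × s ⊆ e
enlarge []            zero    _       _ = [] , refl , id
enlarge (inside  ∷ s) (suc k) (s≤s p) (s≤s q) with enlarge s k p q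
... | e , ∣e∣≡k , s⊆e = inside ∷ e , cong suc ∣e∣≡k , s⊆s s⊆e
enlarge (outside ∷ s) k       p       q with ℕ.m≤n⇒m<n∨m≡n q
... | inj₂ refl = ⊤ , ∣⊤∣≡n _ , ⊆⊤
... | inj₁ (s≤s k≤n) with enlarge s k p k≤n
...   | e , ∣e∣≡k , s⊆e = outside ∷ e , ∣e∣≡k , out⊆ s⊆e

complete-admissible : r ≤ k → (F : Family r ℓ) → Every F HasEdge →
                      k ≤ n → Admissible F (complete k n)
complete-admissible {r} {k} {n = n} r≤k F hasEdge k≤n G G∈F G↪ =
  proj₂ s-uncovered (fromWitness
    (proj₁ s-uncovered , e , fromWitness (proj₁ e-spec) , λ {x} → proj₂ e-spec {x}))
  where
  open _↪_ G↪
  s : Subset n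
  s = image to (proj₁ (hasEdge G G∈F))
  s-uncovered : ∣ s ∣ ≡ r × ¬ Edge (shadow r (complete k n)) s
  s-uncovered = toWitness (edges (proj₂ (hasEdge G G∈F)))
  extension : ∃[ e ] ∣ e ∣ ≡ k × s ⊆ e
  extension = enlarge s k (ℕ.≤-trans (ℕ.≤-reflexive (proj₁ s-uncovered)) r≤k) k≤n
  e : Subset n
  e = proj₁ extension
  e-spec : ∣ e ∣ ≡ k × s ⊆ e
  e-spec = proj₂ extension

-- The minimum number of edges in a k-graph on n ≥ k vertices such that the
-- complement of its r-shadow is F-free.
L : ExcludedMiddle ℓ → r ≤ k → (F : Family r ℓ) → Every F HasEdge →
    ∀ n → k ≤ n → ℕ
L {k = k} em r≤k F hasEdge n k≤n = proj₁ (minimum em (SizeOfAdmissible n k F)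
  (_ , complete k n , complete-admissible r≤k F hasEdge k≤n , refl))

scaledL : ExcludedMiddle ℓ → 1 ≤ r → r ≤ k → (F : Family r ℓ) → Every F HasEdge →
          ∀ n → k ≤ n → ℚ
scaledL {r = r} em 1≤r r≤k F hasEdge n k≤n =
  (+ L em r≤k F hasEdge n k≤n / (n ^ r)) {{ℕ.m^n≢0 n r {{n≢0}}}}
  where
  n≢0 : NonZero n
  n≢0 = >-nonZero (ℕ.≤-trans 1≤r (ℕ.≤-trans r≤k k≤n))

-- Two-sided Dedekind cuts: Lower q means q < x and Upper q means x < q.
record ℝ : Set₁ where
  field
    Lower Upper   : Pred ℚ _
    inhabitedˡ    : ∃ Lower
    inhabitedᵘ    : ∃ Upper
    downward      : ∀ {p q} → p ℚ.< q → Lower q → Lower p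
    upward        : ∀ {p q} → p ℚ.< q → Upper p → Upper q
    openˡ         : ∀ {p} → Lower p → ∃[ q ] p ℚ.< q × Lower q
    openᵘ         : ∀ {q} → Upper q → ∃[ p ] p ℚ.< q × Upper p
    disjoint      : ∀ {q} → ¬ (Lower q × Upper q)
    located       : ∀ {p q} → p ℚ.< q → Lower p ⊎ Upper q

-- ∣ q - x ∣ < ε, that is, q - ε < x < q + ε.
Within : ℚ → ℚ → ℝ → Set
Within ε q x = ℝ.Lower x (q ℚ.- ε) × ℝ.Upper x (q ℚ.+ ε)

-- Convergence, as n → ∞, of a sequence whose terms are defined for n ≥ k.
_⟶_ : (∀ n → k ≤ n → ℚ) → ℝ → Set
_⟶_ {k} a x = ∀ ε → Positive ε →
  ∃[ N ] (∀ n (k≤n : k ≤ n) → N ≤ n → Within ε (a n k≤n) x)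

{-# OPTIONS --safe #-}

-- Write a n = L n / n^r. Split m q vertices into m classes of size q, and replace each edge x of an
-- optimal k-graph on the m classes by q^r sets, each picking one vertex from every class of x, such
-- that every r-set with vertices in r distinct classes of x is contained in one of them: for
-- q ≡ 1 mod m!, take the graphs of the polynomials of degree < r over ℤ / q at the points
-- 0, …, m - 1, whose differences are units. Cover the r-sets with two vertices in one class by at
-- most (m q)^r / m further edges. Since members of F are pair-covering, an uncovered copy of one of
-- them meets each class at most once and projects to an uncovered copy on the classes. Hence
-- L (m q) ≤ q^r (L m + m^(r-1)), and as L is monotone, a n ≤ a m + 1 / m + O(1 / n) for fixed m.
-- Such a sequence converges to inf (a m + 1 / m).
module Submission where

open import Axiom.ExcludedMiddle using (ExcludedMiddle)
open import Data.Bool.Base using (T)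
import Data.Bool.Properties as Bool
open import Data.Empty using (⊥-elim)
open import Data.Fin.Base using (Fin; zero; suc; toℕ; fromℕ<; combine; remQuot)
import Data.Fin.Properties as Fin
open import Data.Fin.Subset
  using (Subset; inside; outside; _∈_; _∉_; _⊆_; _∪_; _-_; ⁅_⁆; ∣_∣; ⊥)
open import Data.Fin.Subset.Properties
open import Data.Integer.Base as ℤ using (ℤ; +_)
import Data.Integer.DivMod as ℤ
import Data.Integer.Divisibility.Signed as ℤ
import Data.Integer.Properties as ℤ
import Data.Integer.Tactic.RingSolver as ℤSolver
open import Data.List.Base as List
  using (List; []; _∷_; _++_; map; filter; length; allFin; cartesianProductWith; cartesianProduct)
open import Data.List.Membership.Propositional using (find; lose) renaming (_∈_ to _∈ˡ_)
open import Data.List.Membership.Propositional.Properties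
open import Data.List.Properties using (length-map; length-++; length-tabulate; filter-notAll)
open import Data.List.Relation.Unary.All as All using (All; []; _∷_)
import Data.List.Relation.Unary.All.Properties as All
open import Data.List.Relation.Unary.AllPairs using ([]; _∷_)
open import Data.List.Relation.Unary.Any as Any using (Any; here; there)
import Data.List.Relation.Unary.Any.Properties as Any
open import Data.List.Relation.Unary.Unique.Propositional using (Unique)
import Data.List.Relation.Unary.Unique.Propositional.Properties as Unique
open import Data.Nat.Base hiding (∣_-_∣; _/_; _%_)
open import Data.Nat.DivMod using (_/_; _%_; m≡m%n+[m/n]*n; m%n<n; m/n*n≤m)
open import Data.Nat.Divisibility using (_∣_; ∣-trans; m≤n⇒m!∣n!; m∣m*n; >⇒∤)
open import Data.Nat.Properties
import Data.Nat.Tactic.RingSolver as ℕSolver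
open import Data.Product.Base using (∃-syntax; _×_; _,_; proj₁; proj₂)
open import Data.Rational.Base as ℚ using (ℚ; 0ℚ; 1ℚ; toℚᵘ)
import Data.Rational.Properties as ℚ
open import Data.Rational.Unnormalised.Base as ℚᵘ using (mkℚᵘ; *≡*; *≤*; *<*)
import Data.Rational.Unnormalised.Properties as ℚᵘ
open import Data.Sum.Base using (inj₁; inj₂)
open import Data.Vec.Base as Vec using (Vec; []; _∷_)
open import Data.Vec.Properties using (length-toList; ≡-dec; lookup⇒[]=; []=⇒lookup; lookup∘tabulate)
open import Function.Base using (id; _∘_)
open import Function.Definitions using (Injective)
open import Level using (Level; 0ℓ; Lift)
open import Relation.Binary.Definitions using (DecidableEquality)
open import Relation.Binary.PropositionalEquality renaming (setoid to ≡-setoid)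
open import Relation.Nullary using (¬_; yes; no)
open import Relation.Nullary.Decidable
  using (fromWitness; toWitness; dec-true; isYes≗does; map′; ¬?; _×-dec_)
open import Defs

private
  variable
    ℓ : Level
    A X Y Z : Set
    k m n r v : ℕ

-- Finite subsets and lists

∣s∣≤1+∣s-x∣ : ∀ (s : Subset n) x → ∣ s ∣ ≤ suc ∣ s - x ∣
∣s∣≤1+∣s-x∣ (inside  ∷ s) zero    = s≤s (≤-reflexive (cong ∣_∣ (sym (p─⊥≡p s))))
∣s∣≤1+∣s-x∣ (outside ∷ s) zero    = m≤n⇒m≤1+n (≤-reflexive (cong ∣_∣ (sym (p─⊥≡p s))))
∣s∣≤1+∣s-x∣ (inside  ∷ s) (suc x) = s≤s (∣s∣≤1+∣s-x∣ s x)
∣s∣≤1+∣s-x∣ (outside ∷ s) (suc x) = ∣s∣≤1+∣s-x∣ s x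

x∈s-y⇒x∈s : ∀ (s : Subset n) {x} y → x ∈ s - y → x ∈ s
x∈s-y⇒x∈s s y = p─q⊆p s ⁅ y ⁆

x∉s-x : ∀ (s : Subset n) x → x ∉ s - x
x∉s-x (_ ∷ s) (suc x) (Vec.there p) = x∉s-x s x p
x∉s-x (inside ∷ s) zero ()
x∉s-x (outside ∷ s) zero ()

∣s∣≤length : ∀ {s : Subset n} xs → (∀ {z} → z ∈ s → z ∈ˡ xs) → ∣ s ∣ ≤ length xs
∣s∣≤length {n} {s} []       s⊆xs = ≤-reflexive
  (trans (cong ∣_∣ (Empty-unique λ (_ , z∈s) → Any.¬Any[] (s⊆xs z∈s))) (∣⊥∣≡0 n))
∣s∣≤length {s = s} (x ∷ xs) s⊆xs = ≤-trans (∣s∣≤1+∣s-x∣ s x) (s≤s (∣s∣≤length xs rest))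
  where
  rest : ∀ {z} → z ∈ s - x → z ∈ˡ xs
  rest z∈ with s⊆xs (x∈s-y⇒x∈s s x z∈)
  ... | here refl = ⊥-elim (x∉s-x s x z∈)
  ... | there z∈xs = z∈xs

length≤∣s∣ : ∀ {s : Subset n} {xs} → Unique xs → All (_∈ s) xs → length xs ≤ ∣ s ∣
length≤∣s∣ []           []           = z≤n
length≤∣s∣ (x∉xs ∷ uxs) (x∈s ∷ xs⊆s) = ≤-<-trans
  (length≤∣s∣ uxs (All.zipWith (λ (z∈s , x≢z) → x∈p∧x≢y⇒x∈p-y z∈s (≢-sym x≢z)) (xs⊆s , x∉xs)))
  (x∈p⇒∣p-x∣<∣p∣ x∈s)

elements : Subset n → List (Fin n)
elements s = filter (_∈? s) (allFin _)

∈-elements⁺ : ∀ {s : Subset n} {x} → x ∈ s → x ∈ˡ elements s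
∈-elements⁺ {s = s} x∈s = ∈-filter⁺ (_∈? s) (∈-allFin _) x∈s

elements-unique : ∀ (s : Subset n) → Unique (elements s)
elements-unique s = Unique.filter⁺ (_∈? s) (Unique.allFin⁺ _)

elements⊆ : ∀ (s : Subset n) → All (_∈ s) (elements s)
elements⊆ s = All.all-filter (_∈? s) (allFin _)

length-elements : ∀ (s : Subset n) → length (elements s) ≡ ∣ s ∣
length-elements s = ≤-antisym (length≤∣s∣ (elements-unique s) (elements⊆ s))
                              (∣s∣≤length (elements s) ∈-elements⁺)

setOf : List (Fin n) → Subset n
setOf = List.foldr (λ x s → ⁅ x ⁆ ∪ s) ⊥

∈-setOf⁺ : ∀ {x} {xs : List (Fin n)} → x ∈ˡ xs → x ∈ setOf xs
∈-setOf⁺ {x = x}       (here refl) = x∈p∪q⁺ (inj₁ (x∈⁅x⁆ x))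
∈-setOf⁺ {xs = _ ∷ xs} (there p)   = x∈p∪q⁺ {q = setOf xs} (inj₂ (∈-setOf⁺ p))

∈-setOf⁻ : ∀ (xs : List (Fin n)) {x} → x ∈ setOf xs → x ∈ˡ xs
∈-setOf⁻ []       x∈⊥ = ⊥-elim (∉⊥ x∈⊥)
∈-setOf⁻ (y ∷ xs) x∈  with x∈p∪q⁻ ⁅ y ⁆ (setOf xs) x∈
... | inj₁ x∈⁅y⁆ = here (x∈⁅y⁆⇒x≡y y x∈⁅y⁆)
... | inj₂ x∈xs  = there (∈-setOf⁻ xs x∈xs)

-- Repeated entries make this an inequality. That is enough, since sets that come out too small are
-- enlarged to size k by `enlargeAll`.
∣setOf∣≤length : ∀ (xs : List (Fin n)) → ∣ setOf xs ∣ ≤ length xs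
∣setOf∣≤length xs = ∣s∣≤length xs (∈-setOf⁻ xs)

∈-image⁺ : ∀ (f : Fin m → Fin n) {s x} → x ∈ s → f x ∈ image f s
∈-image⁺ f {s} {x} x∈s = lookup⇒[]= (f x) _
  (trans (lookup∘tabulate _ (f x))
         (dec-true (Fin.any? λ z → (z ∈? s) ×-dec (f z Fin.≟ f x)) (x , x∈s , refl)))

∈-image⁻ : ∀ (f : Fin m → Fin n) {s y} → y ∈ image f s → ∃[ x ] x ∈ s × f x ≡ y
∈-image⁻ f {s} {y} y∈ = toWitness {a? = found?}
  (subst T (sym (trans (isYes≗does found?) (trans (sym (lookup∘tabulate _ y)) ([]=⇒lookup y∈)))) _)
  where
  found? = Fin.any? λ x → (x ∈? s) ×-dec (f x Fin.≟ y)

image⊆ : ∀ (f : Fin m → Fin n) {s t} → (∀ {x} → x ∈ s → f x ∈ t) → image f s ⊆ t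
image⊆ f {s} f[s]⊆t y∈ with ∈-image⁻ f {s} y∈
... | _ , x∈s , refl = f[s]⊆t x∈s

∣image∣ : ∀ {f : Fin m → Fin n} → Injective _≡_ _≡_ f → ∀ s → ∣ image f s ∣ ≡ ∣ s ∣
∣image∣ {f = f} f-inj s = trans (≤-antisym upper lower) eq
  where
  eq : length (map f (elements s)) ≡ ∣ s ∣
  eq = trans (length-map f (elements s)) (length-elements s)
  covered : ∀ {z} → z ∈ image f s → z ∈ˡ map f (elements s)
  covered z∈ with ∈-image⁻ f {s} z∈
  ... | _ , x∈s , refl = ∈-map⁺ f (∈-elements⁺ x∈s)
  upper : ∣ image f s ∣ ≤ length (map f (elements s))
  upper = ∣s∣≤length _ covered
  lower : length (map f (elements s)) ≤ ∣ image f s ∣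
  lower = length≤∣s∣ (Unique.map⁺ f-inj (elements-unique s))
                     (All.map⁺ (All.map (∈-image⁺ f) (elements⊆ s)))

∈-allSubsets : ∀ (s : Subset n) → s ∈ˡ allSubsets n
∈-allSubsets []            = here refl
∈-allSubsets (outside ∷ s) = ∈-++⁺ˡ (∈-map⁺ (outside ∷_) (∈-allSubsets s))
∈-allSubsets {suc n} (inside ∷ s) =
  ∈-++⁺ʳ (map (outside ∷_) (allSubsets n)) (∈-map⁺ (inside ∷_) (∈-allSubsets s))

allSubsets-unique : ∀ n → Unique (allSubsets n)
allSubsets-unique zero    = [] ∷ []
allSubsets-unique (suc n) = Unique.++⁺
  (Unique.map⁺ (λ { refl → refl }) (allSubsets-unique n))
  (Unique.map⁺ (λ { refl → refl }) (allSubsets-unique n))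
  λ (p , q) → disjoint (∈-map⁻ (outside ∷_) p) (∈-map⁻ (inside ∷_) q)
  where
  disjoint : ∀ {s : Subset (suc n)} → (∃[ t ] t ∈ˡ allSubsets n × s ≡ outside ∷ t) →
             ¬ (∃[ t ] t ∈ˡ allSubsets n × s ≡ inside ∷ t)
  disjoint (_ , _ , refl) (_ , _ , ())

length-cartesianProductWith : ∀ (f : X → Y → Z) xs ys →
  length (cartesianProductWith f xs ys) ≡ length xs * length ys
length-cartesianProductWith f []       ys = refl
length-cartesianProductWith f (x ∷ xs) ys = trans
  (length-++ (map (f x) ys))
  (cong₂ _+_ (length-map (f x) ys) (length-cartesianProductWith f xs ys))

vectors : List A → ∀ r → List (Vec A r)
vectors xs zero    = [] ∷ []
vectors xs (suc r) = cartesianProductWith _∷_ xs (vectors xs r)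

∈-vectors : ∀ {xs : List A} → (∀ x → x ∈ˡ xs) → ∀ (w : Vec A r) → w ∈ˡ vectors xs r
∈-vectors total []      = here refl
∈-vectors total (x ∷ w) = ∈-cartesianProductWith⁺ _∷_ (total x) (∈-vectors total w)

length-vectors : ∀ (xs : List A) r → length (vectors xs r) ≡ length xs ^ r
length-vectors xs zero    = refl
length-vectors xs (suc r) = trans (length-cartesianProductWith _∷_ xs (vectors xs r))
                                  (cong (length xs *_) (length-vectors xs r))

-- Blocking lists of sets

-- Filtering the head out of `ys` shortens `ys` strictly and keeps every entry of the tail, as these
-- differ from the head.
unique⊆⇒length≤ : DecidableEquality A → ∀ {xs ys : List A} →
                  Unique xs → All (_∈ˡ ys) xs → length xs ≤ length ys
unique⊆⇒length≤ _≟ᴬ_ []            []             = z≤n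
unique⊆⇒length≤ _≟ᴬ_ {x ∷ _} {ys} (x∉xs ∷ uxs) (x∈ys ∷ xs⊆ys) = ≤-<-trans
  (unique⊆⇒length≤ _≟ᴬ_ uxs (All.zipWith (λ (y∈ys , x≢y) → ∈-filter⁺ ≢x? y∈ys x≢y) (xs⊆ys , x∉xs)))
  (filter-notAll ≢x? ys (Any.map (λ x≡y x≢y → x≢y x≡y) x∈ys))
  where ≢x? = λ y → ¬? (x ≟ᴬ y)

-- Admissible F H in terms of the list xs of edges of H, for sets of arbitrary sizes.
Blocking : Family r ℓ → List (Subset n) → Set ℓ
Blocking {n = n} F xs = Every F λ {v} G → ∀ (f : Fin v → Fin n) → Injective _≡_ _≡_ f →
  ¬ (∀ {e} → Edge G e → ¬ Any (image f e ⊆_) xs)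

fromList : ∀ (xs : List (Subset n)) → All (λ x → ∣ x ∣ ≡ k) xs → Graph k n
fromList xs sizes = comprehension (λ e → Any.any? (≡-dec Bool._≟_ e) xs) λ e∈xs → All.lookup sizes e∈xs

edgeCount-fromList : ∀ (xs : List (Subset n)) (sizes : All (λ x → ∣ x ∣ ≡ k) xs) →
                     edgeCount (fromList xs sizes) ≤ length xs
edgeCount-fromList {n} xs sizes = unique⊆⇒length≤ (≡-dec Bool._≟_)
  (Unique.filter⁺ (edge? (fromList xs sizes)) (allSubsets-unique n))
  (All.map toWitness (All.all-filter (edge? (fromList xs sizes)) (allSubsets n)))

-- Larger sets cover more, so the constructions below need only bound the sizes of their sets by k.
enlargeAll : k ≤ n → ∀ (xs : List (Subset n)) → All (λ x → ∣ x ∣ ≤ k) xs →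
             ∃[ ys ] length ys ≡ length xs × All (λ y → ∣ y ∣ ≡ k) ys ×
             (∀ {s} → Any (s ⊆_) xs → Any (s ⊆_) ys)
enlargeAll k≤n []       []              = [] , refl , [] , λ ()
enlargeAll {k} k≤n (x ∷ xs) (∣x∣≤k ∷ sizes)
  with enlarge x k ∣x∣≤k k≤n | enlargeAll k≤n xs sizes
... | y , ∣y∣≡k , x⊆y | ys , len , sizes′ , above =
  y ∷ ys , cong suc len , ∣y∣≡k ∷ sizes′ ,
  λ { (here s⊆x) → here λ z∈s → x⊆y (s⊆x z∈s) ; (there p) → there (above p) }

-- Injectivity of `f` keeps `image f e` at size r, so it is an edge of the complement of the shadow
-- as soon as no edge of `H` contains it.
edges-blocking : ∀ (F : Family r ℓ) (H : Graph k n) → Admissible F H →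
                 Blocking F (filter (edge? H) (allSubsets n))
edges-blocking F H admissible G G∈F f f-inj uncovered = admissible G G∈F record
  { to        = f
  ; injective = f-inj
  ; edges     = λ {e} e∈G → fromWitness
      ( trans (∣image∣ f-inj e) (Graph.uniform G e∈G)
      , λ inShadow → uncovered e∈G (covered (proj₂ (toWitness inShadow))) )
  }
  where
  covered : ∀ {s} → ∃[ h ] Edge H h × s ⊆ h → Any (s ⊆_) (filter (edge? H) (allSubsets _))
  covered (h , h∈H , s⊆h) = lose (∈-filter⁺ (edge? H) (∈-allSubsets h) h∈H) λ {x} → s⊆h {x}

fromList-admissible : ∀ (F : Family r ℓ) {xs : List (Subset n)} (sizes : All (λ x → ∣ x ∣ ≡ k) xs) →
                      Blocking F xs → Admissible F (fromList xs sizes)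
fromList-admissible F {xs} sizes blocking G G∈F G↪ = blocking G G∈F to injective λ e∈G covered →
  proj₂ (toWitness (edges e∈G)) (fromWitness (proj₁ (toWitness (edges e∈G)) , witness covered))
  where
  open _↪_ G↪
  witness : ∀ {s} → Any (s ⊆_) xs → ∃[ y ] Edge (fromList xs sizes) y × s ⊆ y
  witness p with y , y∈xs , s⊆y ← find p = y , fromWitness y∈xs , s⊆y

minimum≤length : ∀ (F : Family r ℓ) {l} → IsMinimum (SizeOfAdmissible n k F) l → k ≤ n →
                 ∀ (xs : List (Subset n)) → All (λ x → ∣ x ∣ ≤ k) xs → Blocking F xs → l ≤ length xs
minimum≤length F (_ , least) k≤n xs sizes blocking with enlargeAll k≤n xs sizes
... | ys , len , sizes′ , above = ≤-trans
  (least _ (fromList ys sizes′ , fromList-admissible F sizes′ blocking′ , refl))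
  (≤-trans (edgeCount-fromList ys sizes′) (≤-reflexive len))
  where
  blocking′ : Blocking F ys
  blocking′ G G∈F f f-inj uncovered =
    blocking G G∈F f f-inj λ e∈G covered → uncovered e∈G (above covered)

minimum-attained : ∀ (F : Family r ℓ) {l} → IsMinimum (SizeOfAdmissible n k F) l →
                   ∃[ xs ] length xs ≡ l × All (λ x → ∣ x ∣ ≤ k) xs × Blocking {n = n} F xs
minimum-attained {n = n} F ((H , admissible , ∣H∣≡l) , _) = _ , ∣H∣≡l ,
  All.map (λ e∈H → ≤-reflexive (Graph.uniform H e∈H)) (All.all-filter (edge? H) (allSubsets n)) ,
  λ {v} → edges-blocking F H admissible {v}

-- This deletes the vertex `zero`: an uncovered copy among the other vertices, shifted by `suc`,
-- would already be uncovered by the original sets.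
Blocking-tail : ∀ (F : Family r ℓ) {xs : List (Subset (suc n))} →
                Blocking F xs → Blocking F (map Vec.tail xs)
Blocking-tail F blocking G G∈F f f-inj uncovered =
  blocking G G∈F (suc ∘ f) (f-inj ∘ Fin.suc-injective) λ {e} e∈G covered →
    uncovered e∈G (Any.map⁺ (Any.map (λ {x} → tail⊆ f {e} {x}) covered))
  where
  tail⊆ : ∀ (f : Fin m → Fin n) {s} {x : Subset (suc n)} →
          image (suc ∘ f) s ⊆ x → image f s ⊆ Vec.tail x
  tail⊆ f {s} {_ ∷ x} ⊆x = image⊆ f λ y∈s → drop-there (⊆x (∈-image⁺ (suc ∘ f) y∈s))

∣tail∣≤ : ∀ (s : Subset (suc n)) → ∣ Vec.tail s ∣ ≤ ∣ s ∣
∣tail∣≤ (x ∷ s) = ∣p∣≤∣x∷p∣ x s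

-- The source of the monotonicity of `L` in the number of vertices: one vertex is deleted for each
-- step of `≤′`.
restrict : ∀ (F : Family r ℓ) → m ≤′ n → (xs : List (Subset n)) →
           All (λ x → ∣ x ∣ ≤ k) xs → Blocking F xs →
           ∃[ ys ] length ys ≡ length xs × All (λ y → ∣ y ∣ ≤ k) ys × Blocking {n = m} F ys
restrict F (≤′-reflexive refl) xs sizes blocking = xs , refl , sizes , λ {v} → blocking {v}
restrict F (≤′-step m≤′n) xs sizes blocking
  with restrict F m≤′n (map Vec.tail xs)
         (All.map⁺ (All.map (λ {x} → ≤-trans (∣tail∣≤ x)) sizes)) (Blocking-tail F {xs} blocking)
... | ys , len , rest = ys , trans len (length-map Vec.tail xs) , rest

-- Interpolation over ℤ / q

eval : Vec ℤ r → ℤ → ℤ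
eval []       x = + 0
eval (c ∷ cs) x = c ℤ.+ x ℤ.* eval cs x

-- The coefficients of v + (X - a) g(X).
newton : ℤ → ℤ → Vec ℤ r → Vec ℤ (suc r)
newton v a []       = v ∷ []
newton v a (g ∷ gs) = (v ℤ.- a ℤ.* g) ∷ newton g a gs

eval-newton : ∀ v a (gs : Vec ℤ r) x → eval (newton v a gs) x ≡ v ℤ.+ (x ℤ.- a) ℤ.* eval gs x
eval-newton v a []       x = base v a x
  where
  base : ∀ v a x → v ℤ.+ x ℤ.* + 0 ≡ v ℤ.+ (x ℤ.- a) ℤ.* + 0
  base = ℤSolver.solve-∀
eval-newton v a (g ∷ gs) x = trans (cong (λ z → v ℤ.- a ℤ.* g ℤ.+ x ℤ.* z) (eval-newton g a gs x))
                                   (step v a g x (eval gs x))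
  where
  step : ∀ v a g x e → v ℤ.- a ℤ.* g ℤ.+ x ℤ.* (g ℤ.+ (x ℤ.- a) ℤ.* e) ≡ v ℤ.+ (x ℤ.- a) ℤ.* (g ℤ.+ x ℤ.* e)
  step = ℤSolver.solve-∀

-- Newton interpolation: after the node `x`, the remaining factor has to take the divided
-- differences (b z - b x) / (a z - a x) at the other nodes, with `u` in place of the reciprocal.
-- `u` is given for all pairs and its property only for distinct ones, so that these values form a
-- total function.
interpolate : ∀ (q : ℤ) (a b : A → ℤ) →
  (∀ x y → ∃[ u ] (x ≢ y → q ℤ.∣ (a y ℤ.- a x) ℤ.* u ℤ.- + 1)) →
  ∀ {zs} → Unique zs → length zs ≡ r →
  ∃[ c ] All (λ z → q ℤ.∣ eval {r} c (a z) ℤ.- b z) zs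
interpolate {r = zero}  q a b inverse {[]} _ _ = [] , []
interpolate {r = suc r} q a b inverse {x ∷ zs} (x∉zs ∷ uzs) len
  with interpolate q a (λ z → proj₁ (inverse x z) ℤ.* (b z ℤ.- b x)) inverse uzs (suc-injective len)
... | g , g-spec = newton (b x) (a x) g , atx ∷ All.zipWith (λ {z} → atz {z}) (g-spec , x∉zs)
  where
  atx : q ℤ.∣ eval (newton (b x) (a x) g) (a x) ℤ.- b x
  atx = ℤ.divides (+ 0) (trans (cong (ℤ._- b x) (eval-newton (b x) (a x) g (a x)))
                               (cancel (b x) (a x) (eval g (a x)) q))
    where
    cancel : ∀ v a e q → v ℤ.+ (a ℤ.- a) ℤ.* e ℤ.- v ≡ + 0 ℤ.* q
    cancel = ℤSolver.solve-∀
  atz : ∀ {z} → q ℤ.∣ eval g (a z) ℤ.- proj₁ (inverse x z) ℤ.* (b z ℤ.- b x) × x ≢ z →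
        q ℤ.∣ eval (newton (b x) (a x) g) (a z) ℤ.- b z
  -- The error at `z` is a combination of two multiples of q: the defect of the inverse `u` and the
  -- error of `g` at `z`.
  atz {z} (q∣ , x≢z) = subst (q ℤ.∣_)
    (sym (trans (cong (ℤ._- b z) (eval-newton (b x) (a x) g (a z)))
                (regroup (b x) (b z) (a x) (a z) (eval g (a z)) (proj₁ (inverse x z)))))
    (ℤ.∣m∣n⇒∣m+n (ℤ.∣n⇒∣m*n (b z ℤ.- b x) (proj₂ (inverse x z) x≢z)) (ℤ.∣n⇒∣m*n (a z ℤ.- a x) q∣))
    where
    regroup : ∀ bx bz ax az e u → bx ℤ.+ (az ℤ.- ax) ℤ.* e ℤ.- bz ≡
              (bz ℤ.- bx) ℤ.* ((az ℤ.- ax) ℤ.* u ℤ.- + 1) ℤ.+ (az ℤ.- ax) ℤ.* (e ℤ.- u ℤ.* (bz ℤ.- bx))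
    regroup = ℤSolver.solve-∀

-- The absolute value of the difference lies between 1 and m, so it is one of the factors of m!.
∣d∣∣m! : ∀ {x y : Fin m} → x ≢ y → + toℕ y ℤ.- + toℕ x ℤ.∣ + (m !)
∣d∣∣m! {m} {x} {y} x≢y = ℤ.∣ᵤ⇒∣ (positive∣! ∣d∣ ∣d∣≢0 ∣d∣≤m)
  where
  ∣d∣ = ℤ.∣ + toℕ y ℤ.- + toℕ x ∣
  ∣d∣≢0 : ∣d∣ ≢ 0
  ∣d∣≢0 d≡0 = x≢y (sym (Fin.toℕ-injective (ℤ.+-injective
    (ℤ.i-j≡0⇒i≡j (+ toℕ y) (+ toℕ x) (ℤ.∣i∣≡0⇒i≡0 d≡0)))))
  ∣d∣≤m : ∣d∣ ≤ m
  ∣d∣≤m = ≤-trans (≤-reflexive (cong ℤ.∣_∣ (ℤ.[+m]-[+n]≡m⊖n (toℕ y) (toℕ x))))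
         (≤-trans (ℤ.∣m⊝n∣≤m⊔n (toℕ y) (toℕ x)) (⊔-lub (Fin.toℕ≤n y) (Fin.toℕ≤n x)))
  positive∣! : ∀ j → j ≢ 0 → j ≤ m → j ∣ m !
  positive∣! zero    j≢0 _   = ⊥-elim (j≢0 refl)
  positive∣! (suc j) _   j≤m = ∣-trans (m∣m*n (j !)) (m≤n⇒m!∣n! j≤m)

difference-invertible : ∀ t (x y : Fin m) →
  ∃[ u ] (x ≢ y → + suc (m ! * t) ℤ.∣ (+ toℕ y ℤ.- + toℕ x) ℤ.* u ℤ.- + 1)
difference-invertible {m} t x y with x Fin.≟ y
... | yes x≡y = + 0 , λ x≢y → ⊥-elim (x≢y x≡y)
... | no  x≢y with ∣d∣∣m! x≢y
-- With m! = e d, the product d (-e t) is -m! t, which is 1 - q; so -e t inverts d modulo q, with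
-- quotient -1.
...   | ℤ.divides e m!≡e*d = ℤ.- (e ℤ.* + t) , λ _ → ℤ.divides (ℤ.- + 1)
  (trans (rearrange (+ toℕ y ℤ.- + toℕ x) e (+ t))
         (cong (λ z → ℤ.- + 1 ℤ.* (+ 1 ℤ.+ z)) (trans (cong (ℤ._* + t) (sym m!≡e*d)) (sym (ℤ.pos-* (m !) t)))))
  where
  rearrange : ∀ d e t → d ℤ.* (ℤ.- (e ℤ.* t)) ℤ.- + 1 ≡ ℤ.- + 1 ℤ.* (+ 1 ℤ.+ e ℤ.* d ℤ.* t)
  rearrange = ℤSolver.solve-∀

module _ (q : ℕ) .{{_ : NonZero q}} where

  residue : ℤ → Fin q
  residue x = fromℕ< (ℤ.n%ℕd<d x q)

  toℤ : Fin q → ℤ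
  toℤ i = + toℕ i

  residue-congruent : ∀ x → + q ℤ.∣ x ℤ.- toℤ (residue x)
  residue-congruent x = ℤ.divides (x ℤ./ℕ q)
    (trans (cong₂ (λ y z → y ℤ.- + z) (ℤ.a≡a%ℕn+[a/ℕn]*n x q) (Fin.toℕ-fromℕ< (ℤ.n%ℕd<d x q)))
           (cancel (+ (x ℤ.%ℕ q)) (x ℤ./ℕ q ℤ.* + q)))
    where
    cancel : ∀ s p → s ℤ.+ p ℤ.- s ≡ p
    cancel = ℤSolver.solve-∀

  congruent⇒≡ : ∀ (i j : Fin q) → + q ℤ.∣ toℤ i ℤ.- toℤ j → i ≡ j
  congruent⇒≡ i j q∣ = Fin.toℕ-injective (ℤ.+-injective (ℤ.i-j≡0⇒i≡j (toℤ i) (toℤ j) (ℤ.∣i∣≡0⇒i≡0 d≡0)))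
    where
    d = ℤ.∣ toℤ i ℤ.- toℤ j ∣
    d<q : d < q
    d<q = ≤-<-trans (≤-trans (≤-reflexive (cong ℤ.∣_∣ (ℤ.[+m]-[+n]≡m⊖n (toℕ i) (toℕ j))))
                             (ℤ.∣m⊝n∣≤m⊔n (toℕ i) (toℕ j)))
                    (⊔-lub (Fin.toℕ<n i) (Fin.toℕ<n j))
    d≡0 : d ≡ 0
    d≡0 with d in eq
    ... | zero  = refl
    ... | suc _ = ⊥-elim (>⇒∤ (subst (_< q) eq d<q) (subst (q ∣_) eq (ℤ.∣⇒∣ᵤ q∣)))

  residue-unique : ∀ {x j} → + q ℤ.∣ x ℤ.- toℤ j → residue x ≡ j
  residue-unique {x} {j} q∣ = congruent⇒≡ (residue x) j
    (subst (+ q ℤ.∣_) (telescope x (toℤ (residue x)) (toℤ j))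
      (ℤ.∣m∣n⇒∣m-n q∣ (residue-congruent x)))
    where
    telescope : ∀ x s j → (x ℤ.- j) ℤ.- (x ℤ.- s) ≡ s ℤ.- j
    telescope = ℤSolver.solve-∀

  evalMod : Vec (Fin q) r → Fin m → Fin q
  evalMod w i = residue (eval (Vec.map toℤ w) (+ toℕ i))

  -- Reducing the coefficients is harmless modulo q, so the q^r vectors over `Fin q` represent all
  -- polynomials of degree < r.
  eval-residue : ∀ (c : Vec ℤ r) x → + q ℤ.∣ eval c x ℤ.- eval (Vec.map toℤ (Vec.map residue c)) x
  eval-residue []       x = ℤ.divides (+ 0) refl
  eval-residue (c ∷ cs) x = subst (+ q ℤ.∣_)
    (regroup c (toℤ (residue c)) x (eval cs x) (eval (Vec.map toℤ (Vec.map residue cs)) x))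
    (ℤ.∣m∣n⇒∣m+n (residue-congruent c) (ℤ.∣n⇒∣m*n x (eval-residue cs x)))
    where
    regroup : ∀ c c′ x e e′ → (c ℤ.- c′) ℤ.+ x ℤ.* (e ℤ.- e′) ≡ (c ℤ.+ x ℤ.* e) ℤ.- (c′ ℤ.+ x ℤ.* e′)
    regroup = ℤSolver.solve-∀

-- The reason why q^r transversals per edge suffice: injectivity of `p` makes the r nodes distinct,
-- and differences of distinct nodes are units modulo 1 + m! t.
interpolateMod : ∀ q .{{_ : NonZero q}} t → q ≡ suc (m ! * t) →
  ∀ (p : Fin v → Fin m) (b : Fin v → Fin q) → Injective _≡_ _≡_ p →
  ∀ (e : Subset v) → ∣ e ∣ ≡ r → ∃[ w ] (∀ {z} → z ∈ e → evalMod q {r} w (p z) ≡ b z)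
interpolateMod {m} {r = r} q t refl p b p-inj e ∣e∣≡r
  with interpolate (+ q) (λ z → + toℕ (p z)) (λ z → + toℕ (b z))
         (λ x y → let (u , spec) = difference-invertible t (p x) (p y) in u , λ x≢y → spec (x≢y ∘ p-inj))
         (elements-unique e) (trans (length-elements e) ∣e∣≡r)
... | c , spec = Vec.map (residue q) c , λ {z} z∈e →
  let x = + toℕ (p z)
      reduced = eval (Vec.map (toℤ q) (Vec.map (residue q) c)) x
  in residue-unique q {x = reduced} (subst (+ q ℤ.∣_)
    (telescope (eval c x) (+ toℕ (b z)) reduced)
    (ℤ.∣m∣n⇒∣m-n (All.lookup spec (∈-elements⁺ z∈e)) (eval-residue q c x)))
  where
  telescope : ∀ x b s → (x ℤ.- b) ℤ.- (x ℤ.- s) ≡ s ℤ.- b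
  telescope = ℤSolver.solve-∀

-- The blow-up

pad : A → ∀ (xs : List A) → length xs ≤ r → ∃[ w ] (∀ {z} → z ∈ˡ xs → z ∈ˡ Vec.toList {n = r} w)
pad {r = r} d []       _         = Vec.replicate r d , λ ()
pad         d (x ∷ xs) (s≤s len) with pad d xs len
... | w , xs⊆w = x ∷ w , λ { (here z≡x) → here z≡x ; (there z∈xs) → there (xs⊆w z∈xs) }

class : ∀ (m q : ℕ) → Fin (m * q) → Fin m
class m q x = proj₁ (remQuot {m} q x)

position : ∀ (m q : ℕ) → Fin (m * q) → Fin q
position m q x = proj₂ (remQuot {m} q x)

combine-class-position : ∀ m q x → combine (class m q x) (position m q x) ≡ x
combine-class-position m q = Fin.combine-remQuot {m} q

sameClass : ∀ m q → List (Fin (m * q) × Fin (m * q))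
sameClass m q = cartesianProductWith (λ i (a , b) → combine i a , combine i b)
                                     (allFin m) (cartesianProduct (allFin q) (allFin q))

∈-sameClass : ∀ m q {x y} → class m q x ≡ class m q y → (x , y) ∈ˡ sameClass m q
∈-sameClass m q {x} {y} eq = subst (_∈ˡ sameClass m q)
  (cong₂ _,_ (combine-class-position m q x)
             (trans (cong (λ i → combine i (position m q y)) eq) (combine-class-position m q y)))
  (∈-cartesianProductWith⁺ _ (∈-allFin (class m q x))
    (∈-cartesianProduct⁺ (∈-allFin (position m q x)) (∈-allFin (position m q y))))

length-allFin : ∀ n → length (allFin n) ≡ n
length-allFin n = length-tabulate id

length-sameClass : ∀ m q → length (sameClass m q) ≡ m * (q * q)
length-sameClass m q = trans (length-cartesianProductWith _ (allFin m) (cartesianProduct (allFin q) (allFin q)))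
  (cong₂ _*_ (length-allFin m)
    (trans (length-cartesianProductWith _,_ (allFin q) (allFin q))
           (cong₂ _*_ (length-allFin q) (length-allFin q))))

collision : Fin n × Fin n → Vec (Fin n) r → Subset n
collision (x , y) w = setOf (x ∷ y ∷ Vec.toList w)

-- Two vertices of one class are followed by r - 2 arbitrary vertices. For r < 2 no r-set has two
-- vertices, and nothing has to be covered.
collisions : ∀ m q (r : ℕ) → List (Subset (m * q))
collisions m q zero          = []
collisions m q (suc zero)    = []
collisions m q (suc (suc r)) =
  cartesianProductWith collision (sameClass m q) (vectors (allFin (m * q)) r)

^-distribʳ-* : ∀ m n o → (m * n) ^ o ≡ m ^ o * n ^ o
^-distribʳ-* m n zero    = refl
^-distribʳ-* m n (suc o) = trans (cong (m * n *_) (^-distribʳ-* m n o)) ([m*n]*[o*p]≡[m*o]*[n*p] m n (m ^ o) (n ^ o))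

-- The first two vertices share their class, so r positions but only r - 1 classes are chosen.
length-collisions : ∀ m q r → length (collisions m q r) ≤ q ^ r * m ^ pred r
length-collisions m q zero          = z≤n
length-collisions m q (suc zero)    = z≤n
length-collisions m q (suc (suc r)) = ≤-reflexive
  (trans (length-cartesianProductWith collision (sameClass m q) (vectors (allFin (m * q)) r))
  (trans (cong₂ _*_ (length-sameClass m q)
           (trans (length-vectors (allFin (m * q)) r)
           (trans (cong (_^ r) (length-allFin (m * q))) (^-distribʳ-* m q r))))
         (rearrange m q (m ^ r) (q ^ r))))
  where
  rearrange : ∀ m q a b → m * (q * q) * (a * b) ≡ q * (q * b) * (m * a)
  rearrange = ℕSolver.solve-∀

collisions-size : ∀ r → r ≤ k → ∀ m q → All (λ x → ∣ x ∣ ≤ k) (collisions m q r)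
collisions-size zero          r≤k m q = []
collisions-size (suc zero)    r≤k m q = []
collisions-size {k} (suc (suc r)) r≤k m q =
  All.cartesianProductWith⁺ (≡-setoid _) (≡-setoid _) collision
    (sameClass m q) (vectors (allFin (m * q)) r) λ {xy} {w} _ _ → small xy w
  where
  small : ∀ xy (w : Vec (Fin (m * q)) r) → ∣ collision xy w ∣ ≤ k
  small (x , y) w = ≤-trans (∣setOf∣≤length (x ∷ y ∷ Vec.toList w))
    (≤-trans (s≤s (s≤s (≤-reflexive (length-toList w)))) r≤k)

collisions-cover : ∀ m q {s x y} → ∣ s ∣ ≤ r → x ∈ s → y ∈ s → x ≢ y →
                   class m q x ≡ class m q y → Any (s ⊆_) (collisions m q r)
collisions-cover {r} m q {s} {x} {y} ∣s∣≤r x∈s y∈s x≢y same = go r (≤-trans two-less ∣s∣≤r)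
  where
  rest = s - x - y
  two-less : suc (suc ∣ rest ∣) ≤ ∣ s ∣
  two-less = ≤-<-trans (x∈p⇒∣p-x∣<∣p∣ (x∈p∧x≢y⇒x∈p-y y∈s (≢-sym x≢y))) (x∈p⇒∣p-x∣<∣p∣ x∈s)
  go : ∀ r → suc (suc ∣ rest ∣) ≤ r → Any (s ⊆_) (collisions m q r)
  go (suc (suc r)) (s≤s (s≤s len))
    -- Having two distinct elements forces r ≥ 2. Vacant entries of the vector are filled with `x`,
    -- which is listed already.
    with pad x (elements rest) (≤-trans (≤-reflexive (length-elements rest)) len)
  ... | w , rest⊆w = lose
    (∈-cartesianProductWith⁺ collision (∈-sameClass m q same) (∈-vectors ∈-allFin w))
    λ {z} z∈s → ∈-setOf⁺ (listed z z∈s)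
    where
    listed : ∀ z → z ∈ s → z ∈ˡ x ∷ y ∷ Vec.toList w
    listed z z∈s with z Fin.≟ x | z Fin.≟ y
    ... | yes z≡x | _       = here z≡x
    ... | no  _   | yes z≡y = there (here z≡y)
    ... | no  z≢x | no  z≢y = there (there (rest⊆w
      (∈-elements⁺ (x∈p∧x≢y⇒x∈p-y (x∈p∧x≢y⇒x∈p-y z∈s z≢x) z≢y))))

-- The graph, over the classes in `x`, of the polynomial with coefficients `w`.
transversal : ∀ q .{{_ : NonZero q}} → Subset m → Vec (Fin q) r → Subset (m * q)
transversal q x w = setOf (map (λ i → combine i (evalMod q w i)) (elements x))

∣transversal∣≤ : ∀ q .{{_ : NonZero q}} (x : Subset m) (w : Vec (Fin q) r) → ∣ transversal q x w ∣ ≤ ∣ x ∣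
∣transversal∣≤ q x w = ≤-trans (∣setOf∣≤length (map lift (elements x)))
  (≤-reflexive (trans (length-map lift (elements x)) (length-elements x)))
  where lift = λ i → combine i (evalMod q w i)

blowup : ∀ r q .{{_ : NonZero q}} → List (Subset m) → List (Subset (m * q))
blowup {m} r q xs =
  cartesianProductWith (transversal q) xs (vectors (allFin q) r) ++ collisions m q r

length-blowup : ∀ r q .{{_ : NonZero q}} (xs : List (Subset m)) →
                length (blowup r q xs) ≤ q ^ r * (length xs + m ^ pred r)
length-blowup {m} r q xs = begin
  length (blowup r q xs)                           ≡⟨ length-++ transversals ⟩
  length transversals + length (collisions m q r)  ≤⟨ +-monoʳ-≤ (length transversals) (length-collisions m q r) ⟩
  length transversals + q ^ r * m ^ pred r         ≡⟨ cong (_+ q ^ r * m ^ pred r) count ⟩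
  q ^ r * length xs + q ^ r * m ^ pred r           ≡⟨ *-distribˡ-+ (q ^ r) (length xs) (m ^ pred r) ⟨
  q ^ r * (length xs + m ^ pred r)                 ∎
  where
  open ≤-Reasoning
  transversals = cartesianProductWith (transversal q) xs (vectors (allFin q) r)
  count : length transversals ≡ q ^ r * length xs
  count = trans (length-cartesianProductWith (transversal q) xs (vectors (allFin q) r))
    (trans (cong (length xs *_) (trans (length-vectors (allFin q) r) (cong (_^ r) (length-allFin q))))
           (*-comm (length xs) (q ^ r)))

blowup-size : r ≤ k → ∀ q .{{_ : NonZero q}} {xs : List (Subset m)} →
              All (λ x → ∣ x ∣ ≤ k) xs → All (λ x → ∣ x ∣ ≤ k) (blowup r q xs)
blowup-size {r} {m = m} r≤k q {xs} sizes = All.++⁺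
  (All.cartesianProductWith⁺ (≡-setoid _) (≡-setoid _) (transversal q) xs (vectors (allFin q) r)
    λ {x} {w} x∈xs _ → ≤-trans (∣transversal∣≤ q x w) (All.lookup sizes x∈xs))
  (collisions-size r r≤k m q)

blowup-blocking : ∀ (F : Family r ℓ) → Every F PairCovering →
                  ∀ q .{{_ : NonZero q}} t → q ≡ suc (m ! * t) →
                  ∀ {xs : List (Subset m)} → Blocking F xs → Blocking F (blowup r q xs)
blowup-blocking {r} {m = m} F pairCovering q t q≡ {xs} blocking {v} G G∈F f f-inj uncovered =
  blocking G G∈F p p-inj λ e∈G covered →
    let (x , x∈xs , pe⊆x) = find covered in uncovered e∈G (Any.++⁺ˡ (lifted e∈G x∈xs pe⊆x))
  where
  p : Fin v → Fin m
  p = class m q ∘ f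
  b : Fin v → Fin q
  b = position m q ∘ f
  p-inj : Injective _≡_ _≡_ p
  p-inj {x} {y} px≡py with x Fin.≟ y
  ... | yes x≡y = x≡y
  -- Two vertices sent to one class lie in a common edge of `G`, and the image of that edge is
  -- covered by a collision.
  ... | no  x≢y with pairCovering G G∈F x y x≢y
  ...   | e , e∈G , x∈e , y∈e = ⊥-elim (uncovered e∈G (Any.++⁺ʳ _
    (collisions-cover m q (≤-reflexive (trans (∣image∣ f-inj e) (Graph.uniform G e∈G)))
      (∈-image⁺ f x∈e) (∈-image⁺ f y∈e) (x≢y ∘ f-inj) px≡py)))
  lifted : ∀ {e x} → Edge G e → x ∈ˡ xs → image p e ⊆ x →
           Any (image f e ⊆_) (cartesianProductWith (transversal q) xs (vectors (allFin q) r))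
  -- A single polynomial takes the value `b z` at the class `p z` for all `z` in `e`, so its graph
  -- over `x` contains `image f e`.
  lifted {e} {x} e∈G x∈xs pe⊆x with interpolateMod q t q≡ p b p-inj e (Graph.uniform G e∈G)
  ... | w , w-spec = lose (∈-cartesianProductWith⁺ (transversal q) x∈xs (∈-vectors ∈-allFin w))
    (image⊆ f λ {z} z∈e → ∈-setOf⁺ (subst (_∈ˡ map (λ i → combine i (evalMod q w i)) (elements x))
      (trans (cong (combine (p z)) (w-spec z∈e)) (combine-class-position m q (f z)))
      (∈-map⁺ _ (∈-elements⁺ (pe⊆x (∈-image⁺ p z∈e))))))

-- Limits of rational sequences

toℚᵘ-/ : ∀ c d → toℚᵘ (+ c ℚ./ suc d) ℚᵘ.≃ mkℚᵘ (+ c) d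
toℚᵘ-/ c d = ℚ.toℚᵘ-fromℚᵘ (mkℚᵘ (+ c) d)

/-homo-+ : ∀ a b d → + a ℚ./ suc d ℚ.+ + b ℚ./ suc d ≡ + (a + b) ℚ./ suc d
/-homo-+ a b d = ℚ.toℚᵘ-injective (ℚᵘ.≃-trans (ℚ.toℚᵘ-homo-+ (+ a ℚ./ suc d) (+ b ℚ./ suc d))
  (ℚᵘ.≃-trans (ℚᵘ.+-cong (toℚᵘ-/ a d) (toℚᵘ-/ b d))
  (ℚᵘ.≃-trans (*≡* (common (+ a) (+ b) (+ suc d))) (ℚᵘ.≃-sym (toℚᵘ-/ (a + b) d)))))
  where
  common : ∀ a b d → (a ℤ.* d ℤ.+ b ℤ.* d) ℤ.* d ≡ (a ℤ.+ b) ℤ.* (d ℤ.* d)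
  common = ℤSolver.solve-∀

0≤/ : ∀ c d .{{_ : NonZero d}} → 0ℚ ℚ.≤ + c ℚ./ d
0≤/ c d = ℚ.nonNegative⁻¹ (+ c ℚ./ d) {{ℚ.normalize-nonNeg c d}}

/<-positive : ∀ ε → ℚ.Positive ε → ∀ c → ∃[ N ] (∀ n → N ≤ n → + c ℚ./ suc n ℚ.< ε)
-- For ε = (p + 1) / (d + 1) the claim is c (d + 1) < (p + 1) (n + 1), and p + 1 ≥ 1.
/<-positive ε@(ℚ.mkℚ (ℤ.+[1+ p ]) d _) _ c = c * suc d , λ n N≤n →
  ℚ.toℚᵘ-cancel-< (ℚᵘ.<-respˡ-≃ (ℚᵘ.≃-sym (toℚᵘ-/ c n))
    (*<* (subst₂ ℤ._<_ (ℤ.pos-* c (suc d)) (ℤ.pos-* (suc p) (suc n))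
      (ℤ.+<+ (≤-trans (s≤s N≤n) (m≤m+n (suc n) (p * suc n)))))))

<-unbounded : ∀ q d → ∃[ t ] q ℚ.< + t ℚ./ suc d
<-unbounded q@(ℚ.mkℚ i e _) d = t , ℚ.toℚᵘ-cancel-< (ℚᵘ.<-respʳ-≃ (ℚᵘ.≃-sym (toℚᵘ-/ t d))
  (*<* (ℤ.≤-<-trans (ℤ.*-monoʳ-≤-nonNeg (+ suc d) (i≤∣i∣ i))
    (subst₂ ℤ._<_ (ℤ.pos-* ℤ.∣ i ∣ (suc d)) (ℤ.pos-* t (suc e))
      (ℤ.+<+ (m≤m*n t (suc e)))))))
  where
  t = suc (ℤ.∣ i ∣ * suc d)
  i≤∣i∣ : ∀ i → i ℤ.≤ + ℤ.∣ i ∣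
  i≤∣i∣ (+ n)      = ℤ.≤-refl
  i≤∣i∣ ℤ.-[1+ n ] = ℤ.-≤+

module _ where
  open ℚ.≤-Reasoning

  p<p+ε : ∀ p {ε} → 0ℚ ℚ.< ε → p ℚ.< p ℚ.+ ε
  p<p+ε p {ε} 0<ε = begin-strict
    p            ≡⟨ ℚ.+-identityʳ p ⟨
    p ℚ.+ 0ℚ     <⟨ ℚ.+-monoʳ-< p 0<ε ⟩
    p ℚ.+ ε      ∎

  p<q+ε⇒p-ε<q : ∀ {p} q ε → p ℚ.< q ℚ.+ ε → p ℚ.- ε ℚ.< q
  p<q+ε⇒p-ε<q {p} q ε p<q+ε = begin-strict
    p ℚ.- ε                 <⟨ ℚ.+-monoˡ-< (ℚ.- ε) p<q+ε ⟩
    (q ℚ.+ ε) ℚ.- ε         ≡⟨ ℚ.+-assoc q ε (ℚ.- ε) ⟩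
    q ℚ.+ (ε ℚ.- ε)         ≡⟨ cong (q ℚ.+_) (ℚ.+-inverseʳ ε) ⟩
    q ℚ.+ 0ℚ                ≡⟨ ℚ.+-identityʳ q ⟩
    q                       ∎

-- c ⟋ n is c / n for n ≥ 1; at n = 0 it is c.
infix 7 _⟋_
_⟋_ : ℕ → ℕ → ℚ
c ⟋ n = + c ℚ./ suc (pred n)

⟋<-positive : ∀ ε → ℚ.Positive ε → ∀ c → ∃[ N ] (∀ n → N ≤ n → c ⟋ n ℚ.< ε)
⟋<-positive ε ε>0 c with /<-positive ε ε>0 c
... | N , small = suc N , λ { (suc n) (s≤s N≤n) → small n N≤n }

module Limit (em : ExcludedMiddle 0ℓ) (a : ∀ n → k ≤ n → ℚ)
  (a≥0 : ∀ n k≤n → 0ℚ ℚ.≤ a n k≤n)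
  (bound : ∀ m k≤m → ∃[ c ] (∀ n k≤n → a n k≤n ℚ.≤ (a m k≤m ℚ.+ 1 ⟋ m) ℚ.+ c ⟋ n))
  where

  c : ∀ m → k ≤ m → ℚ
  c m k≤m = a m k≤m ℚ.+ 1 ⟋ m

  0≤c : ∀ m k≤m → 0ℚ ℚ.≤ c m k≤m
  0≤c m k≤m = ℚ.+-mono-≤ (a≥0 m k≤m) (0≤/ 1 (suc (pred m)))

  Below Above : ℚ → Set
  Below q = ∀ m k≤m → q ℚ.≤ c m k≤m
  Above q = ∃[ m ] ∃[ k≤m ] c m k≤m ℚ.< q

  -- The cut of the infimum of `c`. `Lower q` asks for a lower bound strictly above q, because the
  -- set of all lower bounds contains the infimum and is not open.
  limit : ℝ
  limit = record
    { Lower      = λ q → ∃[ p ] q ℚ.< p × Below p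
    ; Upper      = Above
    ; inhabitedˡ = ℚ.- 1ℚ , 0ℚ , ℚ.negative⁻¹ (ℚ.- 1ℚ) , 0≤c
    ; inhabitedᵘ = c k ≤-refl ℚ.+ 1ℚ , k , ≤-refl , p<p+ε (c k ≤-refl) (ℚ.positive⁻¹ 1ℚ)
    ; downward   = λ p<q (z , q<z , below) → z , ℚ.<-trans p<q q<z , below
    ; upward     = λ p<q (m , k≤m , cm<p) → m , k≤m , ℚ.<-trans cm<p p<q
    ; openˡ      = λ (z , p<z , below) →
                     let (y , p<y , y<z) = ℚ.<-dense p<z in y , p<y , z , y<z , below
    ; openᵘ      = λ (m , k≤m , cm<q) →
                     let (y , cm<y , y<q) = ℚ.<-dense cm<q in y , y<q , m , k≤m , cm<y
    ; disjoint   = λ ((z , q<z , below) , m , k≤m , cm<q) →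
                     ℚ.<-irrefl refl (ℚ.<-trans q<z (ℚ.≤-<-trans (below m k≤m) cm<q))
    ; located    = located
    }
    where
    located : ∀ {p q} → p ℚ.< q → _
    -- If no `c m` is below q, then q itself is a lower bound and witnesses `Lower p`.
    located {p} {q} p<q with em {Above q}
    ... | yes above = inj₂ above
    ... | no ¬above = inj₁ (q , p<q , λ m k≤m → ℚ.≮⇒≥ λ cm<q → ¬above (m , k≤m , cm<q))

  -- Take the least multiple of 1 / (d + 1) exceeding some `c m`. It is not 0, as `c` is
  -- nonnegative, and by minimality its predecessor is a lower bound.
  nearInfimum : ∀ d → ∃[ t ] Below (+ t ℚ./ suc d) × Above (+ suc t ℚ./ suc d)
  nearInfimum d with minimum em (λ t → Above (+ t ℚ./ suc d))
                       (let (t , c<t) = <-unbounded (c k ≤-refl) d in t , k , ≤-refl , c<t)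
  ... | zero  , (m , k≤m , cm<0) , _ =
    ⊥-elim (ℚ.<-irrefl refl (ℚ.<-≤-trans cm<0 (ℚ.≤-trans (ℚ.≤-reflexive (ℚ.0/n≡0 (suc d))) (0≤c m k≤m))))
  ... | suc t , above , least = t ,
    (λ m k≤m → ℚ.≮⇒≥ λ cm<t → 1+n≰n (least t (m , k≤m , cm<t))) , above

  -- By `bound`, the limit superior of `a` is at most every `c m`, hence at most the infimum of `c`.
  -- Conversely the infimum is at most c n = a n + 1 / n.
  converges : a ⟶ limit
  -- With D = d + 1, one 1 / D pays for the gap in `nearInfimum` and another for the error C / n, so
  -- 2 / D < ε is required.
  converges ε ε>0 with ⟋<-positive ε ε>0 1 | /<-positive ε ε>0 2
  ... | N₁ , 1/n<ε | d , 2/D<ε with nearInfimum d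
  ...   | t , below , m , k≤m , cm<t+1 with bound m k≤m
  ...     | C , a≤ with ⟋<-positive (+ 1 ℚ./ suc d) (ℚ.normalize-pos 1 (suc d)) C
  ...       | N₂ , C/n<1/D = N₁ ⊔ N₂ , λ n k≤n N≤n →
    (+ t ℚ./ suc d , p<q+ε⇒p-ε<q (+ t ℚ./ suc d) ε (upper n k≤n (≤-trans (m≤n⊔m N₁ N₂) N≤n)) , below) ,
    (n , k≤n , ℚ.+-monoʳ-< (a n k≤n) (1/n<ε n (≤-trans (m≤m⊔n N₁ N₂) N≤n)))
    where
    open ℚ.≤-Reasoning
    upper : ∀ n k≤n → N₂ ≤ n → a n k≤n ℚ.< + t ℚ./ suc d ℚ.+ ε
    upper n k≤n N₂≤n = begin-strict
      a n k≤n                                  ≤⟨ a≤ n k≤n ⟩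
      c m k≤m ℚ.+ C ⟋ n                        <⟨ ℚ.+-mono-< cm<t+1 (C/n<1/D n N₂≤n) ⟩
      + suc t ℚ./ suc d ℚ.+ + 1 ℚ./ suc d      ≡⟨ /-homo-+ (suc t) 1 d ⟩
      + (suc t + 1) ℚ./ suc d                  ≡⟨ cong (λ s → + s ℚ./ suc d) (+-suc t 1) ⟨
      + (t + 2) ℚ./ suc d                      ≡⟨ /-homo-+ t 2 d ⟨
      + t ℚ./ suc d ℚ.+ + 2 ℚ./ suc d          <⟨ ℚ.+-monoʳ-< (+ t ℚ./ suc d) (2/D<ε d ≤-refl) ⟩
      + t ℚ./ suc d ℚ.+ ε                      ∎

-- Growth of L

-- This is (1 + D / n)^r ≤ 1 + E / n without denominators. In the induction step the product of the
-- two error terms, E D / n^2, is at most E D / n.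
n[n+D]^r≤n^r[n+E] : ∀ D r → ∃[ E ] (∀ n → 1 ≤ n → n * (n + D) ^ r ≤ n ^ r * (n + E))
n[n+D]^r≤n^r[n+E] D zero    = 0 , λ n _ → ≤-reflexive (base n)
  where
  base : ∀ n → n * 1 ≡ 1 * (n + 0)
  base = ℕSolver.solve-∀
n[n+D]^r≤n^r[n+E] D (suc r) with n[n+D]^r≤n^r[n+E] D r
... | E , bound = E + D + E * D , λ n 1≤n → begin
  n * ((n + D) * (n + D) ^ r)                ≡⟨ swap n (n + D) ((n + D) ^ r) ⟩
  (n + D) * (n * (n + D) ^ r)                ≤⟨ *-monoʳ-≤ (n + D) (bound n 1≤n) ⟩
  (n + D) * (n ^ r * (n + E))                ≡⟨ expand n D E (n ^ r) ⟩
  n ^ r * (n * (n + E + D) + 1 * (E * D))    ≤⟨ *-monoʳ-≤ (n ^ r) (+-monoʳ-≤ (n * (n + E + D)) (*-monoˡ-≤ (E * D) 1≤n)) ⟩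
  n ^ r * (n * (n + E + D) + n * (E * D))    ≡⟨ collect n D E (n ^ r) ⟩
  n * n ^ r * (n + (E + D + E * D))          ∎
  where
  open ≤-Reasoning
  swap : ∀ a b c → a * (b * c) ≡ b * (a * c)
  swap = ℕSolver.solve-∀
  expand : ∀ n D E N → (n + D) * (N * (n + E)) ≡ N * (n * (n + E + D) + 1 * (E * D))
  expand = ℕSolver.solve-∀
  collect : ∀ n D E N → N * (n * (n + E + D) + n * (E * D)) ≡ n * N * (n + (E + D + E * D))
  collect = ℕSolver.solve-∀

-- The admissible sizes m (1 + m! t) form an arithmetic progression with difference M = m m!, so
-- rounding n up to one of them costs at most a constant.
next-size : ∀ m → 1 ≤ m → ∃[ D ] (∀ n → ∃[ t ] n ≤ m * suc (m ! * t) × m * suc (m ! * t) ≤ n + D)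
next-size m@(suc _) _ = m + M , λ n → suc (n / M) ,
  (begin
    n                                  ≡⟨ m≡m%n+[m/n]*n n M ⟩
    n % M + n / M * M                  ≤⟨ +-monoˡ-≤ (n / M * M) (<⇒≤ (m%n<n n M)) ⟩
    M + n / M * M                      ≤⟨ m≤n+m (M + n / M * M) m ⟩
    m + (M + n / M * M)                ≡⟨ factor m (m !) (n / M) ⟨
    m * suc (m ! * suc (n / M))        ∎) ,
  (begin
    m * suc (m ! * suc (n / M))        ≡⟨ factor m (m !) (n / M) ⟩
    m + (M + n / M * M)                ≤⟨ +-monoʳ-≤ m (+-monoʳ-≤ M (m/n*n≤m n M)) ⟩
    m + (M + n)                        ≡⟨ shuffle m M n ⟩
    n + (m + M)                        ∎)
  where
  open ≤-Reasoning
  M = m * m !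
  instance
    M≢0 : NonZero M
    M≢0 = m*n≢0 m (m !) {{_}} {{>-nonZero (1≤n! m)}}
  factor : ∀ m f s → m * suc (f * suc s) ≡ m + (m * f + s * (m * f))
  factor = ℕSolver.solve-∀
  shuffle : ∀ m M n → m + (M + n) ≡ n + (m + M)
  shuffle = ℕSolver.solve-∀

/≤/+1⟋+⟋ : ∀ a b c m n A B .{{_ : NonZero m}} .{{_ : NonZero n}} .{{_ : NonZero A}} .{{_ : NonZero B}} →
  a * (B * m * n) ≤ (b * m * n + B * n + c * B * m) * A →
  + a ℚ./ A ℚ.≤ (+ b ℚ./ B ℚ.+ 1 ⟋ m) ℚ.+ c ⟋ n
/≤/+1⟋+⟋ a b c (suc m) (suc n) (suc A) (suc B) le = ℚ.toℚᵘ-cancel-≤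
  (ℚᵘ.≤-respʳ-≃ (ℚᵘ.≃-sym sum≃) (ℚᵘ.≤-respˡ-≃ (ℚᵘ.≃-sym (toℚᵘ-/ a A)) (*≤* le′)))
  where
  sum≃ : toℚᵘ ((+ b ℚ./ suc B ℚ.+ + 1 ℚ./ suc m) ℚ.+ + c ℚ./ suc n) ℚᵘ.≃
         (mkℚᵘ (+ b) B ℚᵘ.+ mkℚᵘ (+ 1) m) ℚᵘ.+ mkℚᵘ (+ c) n
  sum≃ = ℚᵘ.≃-trans (ℚ.toℚᵘ-homo-+ (+ b ℚ./ suc B ℚ.+ + 1 ℚ./ suc m) (+ c ℚ./ suc n))
    (ℚᵘ.+-cong (ℚᵘ.≃-trans (ℚ.toℚᵘ-homo-+ (+ b ℚ./ suc B) (+ 1 ℚ./ suc m))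
                           (ℚᵘ.+-cong (toℚᵘ-/ b B) (toℚᵘ-/ 1 m)))
               (toℚᵘ-/ c n))
  numerator : + (b * suc m * suc n + suc B * suc n + c * suc B * suc m) ≡
    (+ b ℤ.* + suc m ℤ.+ + 1 ℤ.* + suc B) ℤ.* + suc n ℤ.+ + c ℤ.* + (suc B * suc m)
  numerator = trans (cong +_ (regroup b c (suc B) (suc m) (suc n)))
    (trans (ℤ.pos-+ ((b * suc m + 1 * suc B) * suc n) (c * (suc B * suc m)))
    (cong₂ ℤ._+_
      (trans (ℤ.pos-* (b * suc m + 1 * suc B) (suc n)) (cong (ℤ._* + suc n)
        (trans (ℤ.pos-+ (b * suc m) (1 * suc B)) (cong₂ ℤ._+_ (ℤ.pos-* b (suc m)) (ℤ.pos-* 1 (suc B))))))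
      (ℤ.pos-* c (suc B * suc m))))
    where
    regroup : ∀ b c B m n → b * m * n + B * n + c * B * m ≡ (b * m + 1 * B) * n + c * (B * m)
    regroup = ℕSolver.solve-∀
  le′ : + a ℤ.* + (suc B * suc m * suc n) ℤ.≤
        ((+ b ℤ.* + suc m ℤ.+ + 1 ℤ.* + suc B) ℤ.* + suc n ℤ.+ + c ℤ.* + (suc B * suc m)) ℤ.* + suc A
  le′ = subst₂ ℤ._≤_ (ℤ.pos-* a (suc B * suc m * suc n))
    (trans (ℤ.pos-* (b * suc m * suc n + suc B * suc n + c * suc B * suc m) (suc A))
           (cong (ℤ._* + suc A) numerator))
    (ℤ.+≤+ le)

-- The collisions contribute m^(r-1) / m^r = 1 / m, and the factor (n + E) / n contributes the term
-- of order 1 / n.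
fractions-bound : ∀ r → 1 ≤ r → ∀ l b E m n .{{_ : NonZero m}} .{{_ : NonZero n}} →
  n * (m ^ r * l) ≤ n ^ r * (n + E) * (b + m ^ pred r) →
  (+ l ℚ./ (n ^ r)) {{m^n≢0 n r}} ℚ.≤
  ((+ b ℚ./ (m ^ r)) {{m^n≢0 m r}} ℚ.+ 1 ⟋ m) ℚ.+ (E * (b + m ^ pred r)) ⟋ n
fractions-bound (suc r) _ l b E m n {{m≢0}} {{n≢0}} growth =
  /≤/+1⟋+⟋ l b (E * B) m n N M {{m≢0}} {{n≢0}} {{m^n≢0 n (suc r)}} {{m^n≢0 m (suc r)}} (begin
    l * (M * m * n)                           ≡⟨ gather l M m n ⟩
    m * (n * (M * l))                         ≤⟨ *-monoʳ-≤ m growth ⟩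
    m * (N * (n + E) * B)                     ≡⟨ distribute m n (m ^ r) N E b ⟩
    (b * m * n + M * n + E * B * m * 1) * N
      -- The exact error is E B / (M n); since M ≥ 1 it is bounded by E B / n, whose numerator is a
      -- natural number.
      ≤⟨ *-monoˡ-≤ N (+-monoʳ-≤ (b * m * n + M * n) (*-monoʳ-≤ (E * B * m) (m^n>0 m (suc r)))) ⟩
    (b * m * n + M * n + E * B * m * M) * N
      ≡⟨ cong (λ z → (b * m * n + M * n + z) * N) (commute (E * B) m M) ⟩
    (b * m * n + M * n + E * B * M * m) * N   ∎)
  where
  open ≤-Reasoning
  B = b + m ^ r
  M = m ^ suc r
  N = n ^ suc r
  gather : ∀ l M m n → l * (M * m * n) ≡ m * (n * (M * l))
  gather = ℕSolver.solve-∀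
  distribute : ∀ m n a N E b → m * (N * (n + E) * (b + a)) ≡
               (b * m * n + m * a * n + E * (b + a) * m * 1) * N
  distribute = ℕSolver.solve-∀
  commute : ∀ c m M → c * m * M ≡ c * M * m
  commute = ℕSolver.solve-∀

module Minima (1≤r : 1 ≤ r) (r≤k : r ≤ k) (F : Family r ℓ) (pairCovering : Every F PairCovering)
  (Lₙ : ∀ n → k ≤ n → ℕ)
  (Lₙ-minimum : ∀ n k≤n → IsMinimum (SizeOfAdmissible n k F) (Lₙ n k≤n))
  where

  -- An optimal list on m vertices is blown up to m q vertices and then cut down to n of them.
  L-blowup : ∀ m (k≤m : k ≤ m) n (k≤n : k ≤ n) t → n ≤ m * suc (m ! * t) →
             Lₙ n k≤n ≤ suc (m ! * t) ^ r * (Lₙ m k≤m + m ^ pred r)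
  L-blowup m k≤m n k≤n t n≤mq with minimum-attained F (Lₙ-minimum m k≤m)
  ... | xs , ∣xs∣ , sizes , blocking = go (suc (m ! * t)) refl n≤mq
    where
    go : ∀ q .{{_ : NonZero q}} → q ≡ suc (m ! * t) → n ≤ m * q →
         Lₙ n k≤n ≤ q ^ r * (Lₙ m k≤m + m ^ pred r)
    go q q≡ n≤mq with restrict F (≤⇒≤′ n≤mq) (blowup r q xs) (blowup-size r≤k q sizes)
                        (blowup-blocking F pairCovering q t q≡ blocking)
    ... | ys , ∣ys∣ , sizes′ , blocking′ = begin
      Lₙ n k≤n                                ≤⟨ minimum≤length F (Lₙ-minimum n k≤n) k≤n ys sizes′ blocking′ ⟩
      length ys                               ≡⟨ ∣ys∣ ⟩
      length (blowup r q xs)                  ≤⟨ length-blowup r q xs ⟩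
      q ^ r * (length xs + m ^ pred r)        ≡⟨ cong (λ l → q ^ r * (l + m ^ pred r)) ∣xs∣ ⟩
      q ^ r * (Lₙ m k≤m + m ^ pred r)         ∎
      where open ≤-Reasoning

  -- Rounding n up to m q ≤ n + D gives m^r q^r ≤ (n + D)^r. The extra factor n allows this to be
  -- compared with n^r (n + E).
  L-growth : ∀ m (k≤m : k ≤ m) → ∃[ E ] (∀ n (k≤n : k ≤ n) →
    n * (m ^ r * Lₙ n k≤n) ≤ n ^ r * (n + E) * (Lₙ m k≤m + m ^ pred r))
  L-growth m k≤m with next-size m (≤-trans 1≤r (≤-trans r≤k k≤m))
  ... | D , next with n[n+D]^r≤n^r[n+E] D r
  ...   | E , power = E , λ n k≤n → let (t , n≤mq , mq≤n+D) = next n in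
    grow n k≤n (suc (m ! * t)) (L-blowup m k≤m n k≤n t n≤mq) mq≤n+D
    where
    open ≤-Reasoning
    B = Lₙ m k≤m + m ^ pred r
    grow : ∀ n (k≤n : k ≤ n) q → Lₙ n k≤n ≤ q ^ r * B → m * q ≤ n + D →
           n * (m ^ r * Lₙ n k≤n) ≤ n ^ r * (n + E) * B
    grow n k≤n q L≤ mq≤n+D = begin
      n * (m ^ r * Lₙ n k≤n)       ≤⟨ *-monoʳ-≤ n (*-monoʳ-≤ (m ^ r) L≤) ⟩
      n * (m ^ r * (q ^ r * B))    ≡⟨ cong (n *_) (*-assoc (m ^ r) (q ^ r) B) ⟨
      n * (m ^ r * q ^ r * B)      ≡⟨ cong (λ z → n * (z * B)) (^-distribʳ-* m q r) ⟨
      n * ((m * q) ^ r * B)        ≤⟨ *-monoʳ-≤ n (*-monoˡ-≤ B (^-monoˡ-≤ r mq≤n+D)) ⟩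
      n * ((n + D) ^ r * B)        ≡⟨ *-assoc n ((n + D) ^ r) B ⟨
      n * (n + D) ^ r * B          ≤⟨ *-monoˡ-≤ B (power n (≤-trans 1≤r (≤-trans r≤k k≤n))) ⟩
      n ^ r * (n + E) * B          ∎

  scaled : ∀ n → k ≤ n → ℚ
  scaled n k≤n = (+ Lₙ n k≤n ℚ./ (n ^ r)) {{m^n≢0 n r {{>-nonZero (≤-trans 1≤r (≤-trans r≤k k≤n))}}}}

  scaled-bound : ∀ m (k≤m : k ≤ m) → ∃[ c ] (∀ n (k≤n : k ≤ n) →
                 scaled n k≤n ℚ.≤ (scaled m k≤m ℚ.+ 1 ⟋ m) ℚ.+ c ⟋ n)
  scaled-bound m k≤m = let (E , growth) = L-growth m k≤m in E * (Lₙ m k≤m + m ^ pred r) , λ n k≤n →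
    fractions-bound r 1≤r (Lₙ n k≤n) (Lₙ m k≤m) E m n
      {{>-nonZero (≤-trans 1≤r (≤-trans r≤k k≤m))}} {{>-nonZero (≤-trans 1≤r (≤-trans r≤k k≤n))}}
      (growth n k≤n)

-- The limit argument decides statements in `Set`, whereas the family may live at any level.
lower-em : ExcludedMiddle ℓ → ExcludedMiddle 0ℓ
lower-em {ℓ} em {P} = map′ Level.lower Level.lift (em {Lift ℓ P})

theorem1 : ∀ {ℓ : Level} (em : ExcludedMiddle ℓ)
    (k r : ℕ) (1≤r : 1 ≤ r) (r≤k : r ≤ k)
    (F : Family r ℓ) (hasEdge : Every F HasEdge) →
    Every F PairCovering →
    ∃[ x ] (scaledL em 1≤r r≤k F hasEdge ⟶ x)
theorem1 em k r 1≤r r≤k F hasEdge pairCovering = limit , converges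
  where
  open Minima 1≤r r≤k F pairCovering (L em r≤k F hasEdge)
    -- `L` is the first projection of `minimum`, so the second one proves minimality.
    (λ n k≤n → proj₂ (minimum em (SizeOfAdmissible n k F) _))
  open Limit (lower-em em) (scaledL em 1≤r r≤k F hasEdge)
    (λ n k≤n → 0≤/ (L em r≤k F hasEdge n k≤n) (n ^ r)
      {{m^n≢0 n r {{>-nonZero (≤-trans 1≤r (≤-trans r≤k k≤n))}}}})
    scaled-bound
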